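{- Let $P$ be a (nonempty) poset and $\to$ a total binary operation on $P$. Then $(P,\to)$ is a normal ESP-poset if and only if the following conditions hold for all $x,y,z\in P$: (0) $y\le x\to y$; (1) if $x\le y\to z$, then $y\le x\to z$; (2) if $y\le x\le x\to y$, then $x\le y$; (3) if $z$ is a maximal lower bound of $x$ and $y$, then $x\le y\to z$. Moreover, condition (0) may be replaced by the requirement that $P$ has a greatest element; that is, $(P,\to)$ is a normal ESP-poset if and only if $P$ has a greatest element and (1), (2), (3) hold.
   Context: For a poset $P$ and $y\in P$ put $[y)=\{u\in P: y\le u\}$. For $y\le x$, the pseudocomplement $x*y$ of $x$ in $[y)$ is the greatest $u\in[y)$ such that $y$ is the only common lower bound of $u$ and $x$ belonging to $[y)$. The poset $P$ is sectionally pseudocomplemented if $x*y$ exists for all $x,y$ with $y\le x$; the resulting partial operation $*$ (defined on exactly the pairs $(x,y)$ with $y\le x$) is the sectional pseudocomplementation of $P$. $(P,\to)$ is a normal ESP-poset if $P$ is sectionally pseudocomplemented and, for all $x,y\in P$, the set $\{z*y: z\in P,\ x\le z,\ y\le z\}$ has a greatest element and $x\to y$ is equal to it. A maximal lower bound of $x$ and $y$ is a maximal element of the set of common lower bounds of $x$ and $y$ in $P$. -}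

module Defs where

open import Level using (Level; _⊔_)
open import Algebra.Core using (Op₂)
open import Data.Product using (Σ; ∃; _×_; proj₁)
open import Relation.Binary.Bundles using (Poset)
open import Relation.Unary using (Pred; _∈_; _∩_)

module PosetNotions {c ℓ₁ ℓ₂ : Level} (P : Poset c ℓ₁ ℓ₂) where
  open Poset P

  IsGreatest : {ℓ : Level} → Pred Carrier ℓ → Carrier → Set (c ⊔ ℓ₂ ⊔ ℓ)
  IsGreatest S g = g ∈ S × (∀ u → u ∈ S → u ≤ g)

  IsMaximal : {ℓ : Level} → Pred Carrier ℓ → Carrier → Set (c ⊔ ℓ₁ ⊔ ℓ₂ ⊔ ℓ)
  IsMaximal S m = m ∈ S × (∀ u → u ∈ S → m ≤ u → u ≈ m)

  IsOnlyElement : {ℓ : Level} → Pred Carrier ℓ → Carrier → Set (c ⊔ ℓ₁ ⊔ ℓ)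
  IsOnlyElement S a = a ∈ S × (∀ u → u ∈ S → u ≈ a)

  [_⟩ : Carrier → Pred Carrier ℓ₂
  [ y ⟩ u = y ≤ u

  LowerBounds : Carrier → Carrier → Pred Carrier ℓ₂
  LowerBounds x y w = w ≤ x × w ≤ y

  IsMaximalLowerBound : Carrier → Carrier → Carrier → Set (c ⊔ ℓ₁ ⊔ ℓ₂)
  IsMaximalLowerBound x y z = IsMaximal (LowerBounds x y) z

  -- Meaningful only for y ≤ x: p is the pseudocomplement of x in [ y ⟩.
  IsSectionalPseudocomplement : Carrier → Carrier → Carrier → Set (c ⊔ ℓ₁ ⊔ ℓ₂)
  IsSectionalPseudocomplement x y p =
    IsGreatest (λ u → u ∈ [ y ⟩ × IsOnlyElement (LowerBounds u x ∩ [ y ⟩) y) p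

  SectionallyPseudocomplemented : Set (c ⊔ ℓ₁ ⊔ ℓ₂)
  SectionallyPseudocomplemented =
    ∀ x y → y ≤ x → ∃ λ p → IsSectionalPseudocomplement x y p

  -- The partial operation x * y takes the proof of y ≤ x as a third argument.
  -- Its value is determined up to ≈, so neither that proof nor the choice of
  -- witness in SectionallyPseudocomplemented matters.
  sectionalPseudocomplement : SectionallyPseudocomplemented →
                              ∀ x y → y ≤ x → Carrier
  sectionalPseudocomplement spc x y y≤x = proj₁ (spc x y y≤x)

  record IsNormalESPPoset (_⇒_ : Op₂ Carrier) : Set (c ⊔ ℓ₁ ⊔ ℓ₂) where
    field
      sectionallyPseudocomplemented : SectionallyPseudocomplemented

    _*_⟨_⟩ : ∀ x y → y ≤ x → Carrier
    _*_⟨_⟩ = sectionalPseudocomplement sectionallyPseudocomplemented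

    -- { z * y : x ≤ z , y ≤ z }
    Extensions : Carrier → Carrier → Pred Carrier (c ⊔ ℓ₁ ⊔ ℓ₂)
    Extensions x y u =
      ∃ λ z → x ≤ z × Σ (y ≤ z) λ y≤z → u ≈ z * y ⟨ y≤z ⟩

    field
      ⇒-greatest : ∀ x y → IsGreatest (Extensions x y) (x ⇒ y)

{-# OPTIONS --safe #-}
-- Under (1), the map x ↦ x ⇒ y is an antitone Galois connection with itself, so
-- x ⇒ y = ((x ⇒ y) ⇒ y) ⇒ y; since (0), (2), (3) make z ⇒ y the sectional
-- pseudocomplement of z whenever y ≤ z, the value x ⇒ y is attained at
-- z = (x ⇒ y) ⇒ y.  In a normal ESP-poset, a * a is the greatest element t of
-- [ a ⟩, and b ⇒ t = z * t forces z = t, whence b ≤ t for every b.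
module Submission where

open import Algebra.Core using (Op₂)
open import Algebra.Definitions using (Congruent₂)
open import Data.Product using (∃; _×_; _,_; proj₁; proj₂; swap)
open import Function.Bundles using (_⇔_; mk⇔)
open import Relation.Binary.Bundles using (Poset)
open import Relation.Binary.Definitions using (Maximum)
open import Relation.Unary using (_∈_; _∩_)
open import Defs

module _ {c ℓ₁ ℓ₂} (P : Poset c ℓ₁ ℓ₂) where
  open Poset P
  open PosetNotions P

  sectionallyDisjoint-sym : ∀ {u x y} →
    IsOnlyElement (LowerBounds u x ∩ [ y ⟩) y →
    IsOnlyElement (LowerBounds x u ∩ [ y ⟩) y
  sectionallyDisjoint-sym ((y≤ux , y≤y) , only) =
    (swap y≤ux , y≤y) , λ v (v≤xu , y≤v) → only v (swap v≤xu , y≤v)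

  -- With its converse below, this ties (3) to pseudocomplements: for `y ≤ x`, (3) bounds by `x ⇒ y`
  -- every candidate for the pseudocomplement of `x` in `[ y ⟩`.
  sectionallyDisjoint⇒maximalLowerBound : ∀ {u x y} →
    IsOnlyElement (LowerBounds u x ∩ [ y ⟩) y → IsMaximalLowerBound u x y
  sectionallyDisjoint⇒maximalLowerBound ((y≤ux , _) , only) =
    y≤ux , λ v v≤ux y≤v → only v (v≤ux , y≤v)

  maximalLowerBound⇒sectionallyDisjoint : ∀ {u x y} →
    IsMaximalLowerBound u x y → IsOnlyElement (LowerBounds u x ∩ [ y ⟩) y
  maximalLowerBound⇒sectionallyDisjoint (y≤ux , maximal) =
    (y≤ux , refl) , λ v (v≤ux , y≤v) → maximal v v≤ux y≤v

  lowerBound-maximal : ∀ {x y} → y ≤ x → IsMaximalLowerBound x y y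
  lowerBound-maximal y≤x = (y≤x , refl) , λ _ (_ , v≤y) y≤v → antisym v≤y y≤v

  module _ (_⇒_ : Op₂ Carrier) where

    Cond0 = ∀ x y → y ≤ (x ⇒ y)
    Cond1 = ∀ x y z → x ≤ (y ⇒ z) → y ≤ (x ⇒ z)
    Cond2 = ∀ x y → y ≤ x → x ≤ (x ⇒ y) → x ≤ y
    Cond3 = ∀ x y z → IsMaximalLowerBound x y z → x ≤ (y ⇒ z)

    module NormalESPPoset (esp : IsNormalESPPoset _⇒_) where
      open IsNormalESPPoset esp

      *-isSectionalPseudocomplement : ∀ {x y} (y≤x : y ≤ x) →
        IsSectionalPseudocomplement x y (x * y ⟨ y≤x ⟩)
      *-isSectionalPseudocomplement y≤x =
        proj₂ (sectionallyPseudocomplemented _ _ y≤x)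

      *-greatest : ∀ {u x y} (y≤x : y ≤ x) → y ≤ u →
        IsOnlyElement (LowerBounds u x ∩ [ y ⟩) y → u ≤ x * y ⟨ y≤x ⟩
      *-greatest y≤x y≤u disjoint =
        proj₂ (*-isSectionalPseudocomplement y≤x) _ (y≤u , disjoint)

      *≤⇒ : ∀ {x y z} → x ≤ z → (y≤z : y ≤ z) → z * y ⟨ y≤z ⟩ ≤ (x ⇒ y)
      *≤⇒ x≤z y≤z = proj₂ (⇒-greatest _ _) _ (_ , x≤z , y≤z , Eq.refl)

      cond0 : Cond0
      cond0 x y with (_ , _ , y≤z , x⇒y≈z*y) , _ ← ⇒-greatest x y =
        trans (proj₁ (proj₁ (*-isSectionalPseudocomplement y≤z)))
              (reflexive (Eq.sym x⇒y≈z*y))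

      cond1 : Cond1
      cond1 x y z x≤y⇒z
        with (w , y≤w , z≤w , y⇒z≈w*z) , _ ← ⇒-greatest y z
        with (z≤w*z , disjoint) , _ ← *-isSectionalPseudocomplement z≤w =
        -- Disjointness is symmetric, so `w` is a candidate for the pseudocomplement of `w * z`. As
        -- `w * z` lies above both `x` and `z`, this gives `y ≤ w ≤ (w * z) * z ≤ x ⇒ z`.
        trans y≤w
          (trans (*-greatest z≤w*z z≤w (sectionallyDisjoint-sym disjoint))
                 (*≤⇒ (trans x≤y⇒z (reflexive y⇒z≈w*z)) z≤w*z))

      cond2 : Cond2
      cond2 x y y≤x x≤x⇒y
        with (z , x≤z , y≤z , x⇒y≈z*y) , _ ← ⇒-greatest x y
        with (_ , _ , only) , _ ← *-isSectionalPseudocomplement y≤z =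
        -- `x` is a common lower bound of `z * y` and `z` in `[ y ⟩`, so it collapses to `y`.
        reflexive
          (only x ((trans x≤x⇒y (reflexive x⇒y≈z*y) , x≤z) , y≤x))

      cond3 : Cond3
      cond3 x y z z-maximal@((z≤x , z≤y) , _) =
        -- Since `z ≤ y`, the element `y` itself serves as the extension: `x ≤ y * z ≤ y ⇒ z`.
        trans (*-greatest z≤y z≤x
                 (maximalLowerBound⇒sectionallyDisjoint z-maximal))
              (*≤⇒ refl z≤y)

      maximum : Carrier → ∃ λ ⊤ → Maximum _≤_ ⊤
      maximum a = t , b≤t
        where
        t = a * a ⟨ refl ⟩

        a≤t : a ≤ t
        a≤t = proj₁ (proj₁ (*-isSectionalPseudocomplement refl))

        [a⟩≤t : ∀ {u} → u ∈ [ a ⟩ → u ≤ t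
        -- Below `a`, the section `[ a ⟩` contains only `a`, so each of its elements is disjoint
        -- from `a`.
        [a⟩≤t a≤u = *-greatest refl a≤u
          (maximalLowerBound⇒sectionallyDisjoint (lowerBound-maximal a≤u))

        b≤t : Maximum _≤_ t
        -- That `b ⇒ t` is attained supplies a common upper bound `z` of `b` and `t`.
        b≤t b with (_ , b≤z , t≤z , _) , _ ← ⇒-greatest b t =
          trans b≤z ([a⟩≤t (trans a≤t t≤z))

    module Conditions (cond0 : Cond0) (cond1 : Cond1)
                      (cond2 : Cond2) (cond3 : Cond3) where

      ⇒-isSectionalPseudocomplement : ∀ {x y} → y ≤ x →
        IsSectionalPseudocomplement x y (x ⇒ y)
      ⇒-isSectionalPseudocomplement {x} {y} y≤x =
        (cond0 x y , ((cond0 x y , y≤x) , refl) , only) ,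
        λ u (_ , disjoint) →
          cond3 u x y (sectionallyDisjoint⇒maximalLowerBound disjoint)
        where
        only : ∀ u → u ∈ LowerBounds (x ⇒ y) x ∩ [ y ⟩ → u ≈ y
        only u ((u≤x⇒y , u≤x) , y≤u) =
          -- Exchange by (1) gives `u ≤ x ≤ u ⇒ y`, which is the hypothesis of (2) for `u`.
          antisym (cond2 u y y≤u (trans u≤x (cond1 u x y u≤x⇒y))) y≤u

      ≤-⇒⇒ : ∀ x y → x ≤ ((x ⇒ y) ⇒ y)
      ≤-⇒⇒ x y = cond1 (x ⇒ y) x y refl

      ⇒-antitoneˡ : ∀ {x z} y → x ≤ z → (z ⇒ y) ≤ (x ⇒ y)
      ⇒-antitoneˡ {x} {z} y x≤z = cond1 x (z ⇒ y) y (trans x≤z (≤-⇒⇒ z y))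

      isNormalESPPoset : IsNormalESPPoset _⇒_
      isNormalESPPoset = record
        { sectionallyPseudocomplemented =
            λ x y y≤x → x ⇒ y , ⇒-isSectionalPseudocomplement y≤x
        ; ⇒-greatest = λ x y →
            ( (x ⇒ y) ⇒ y , ≤-⇒⇒ x y , cond0 (x ⇒ y) y
            , antisym (≤-⇒⇒ (x ⇒ y) y) (⇒-antitoneˡ y (≤-⇒⇒ x y)) ) ,
            λ _ (_ , x≤z , _ , u≈z⇒y) →
              trans (reflexive u≈z⇒y) (⇒-antitoneˡ y x≤z)
        }

    -- Since `y` is a maximal lower bound of `⊤` and `y`, (3) gives `x ≤ ⊤ ≤ y ⇒ y`, and (1)
    -- exchanges `x` with `y`.
    maximum⇒cond0 : (∃ λ ⊤ → Maximum _≤_ ⊤) → Cond1 → Cond3 → Cond0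
    maximum⇒cond0 (⊤ , ≤⊤) cond1 cond3 x y =
      cond1 x y y (trans (≤⊤ x) (cond3 ⊤ y y (lowerBound-maximal (≤⊤ y))))

theorem6p9 : ∀ {c ℓ₁ ℓ₂} (P : Poset c ℓ₁ ℓ₂) →
  let open Poset P
      open PosetNotions P
  in Carrier →
     (_⇒_ : Op₂ Carrier) → Congruent₂ _≈_ _⇒_ →
     let cond0 = ∀ x y → y ≤ (x ⇒ y)
         cond1 = ∀ x y z → x ≤ (y ⇒ z) → y ≤ (x ⇒ z)
         cond2 = ∀ x y → y ≤ x → x ≤ (x ⇒ y) → x ≤ y
         cond3 = ∀ x y z → IsMaximalLowerBound x y z → x ≤ (y ⇒ z)
     in (IsNormalESPPoset _⇒_ ⇔ (cond0 × cond1 × cond2 × cond3))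
        × (IsNormalESPPoset _⇒_ ⇔ ((∃ λ ⊤ → Maximum _≤_ ⊤) × cond1 × cond2 × cond3))
theorem6p9 P a _⇒_ _ =
  mk⇔ (λ esp → let open NormalESPPoset P _⇒_ esp in cond0 , cond1 , cond2 , cond3)
      (λ (c0 , c1 , c2 , c3) → Conditions.isNormalESPPoset P _⇒_ c0 c1 c2 c3) ,
  mk⇔ (λ esp → let open NormalESPPoset P _⇒_ esp in
                maximum a , cond1 , cond2 , cond3)
      (λ (⊤ , c1 , c2 , c3) →
        Conditions.isNormalESPPoset P _⇒_ (maximum⇒cond0 P _⇒_ ⊤ c1 c3) c1 c2 c3)
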